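{- The value of the maximal flow is sensitive to unwinding: there exists a flow network $N$ such that the value of the maximal flow in $N$ differs from the value of the maximal flow in its unwinding $N_t$.
   Context: **Flow networks.** A flow network is $N=\langle AP,V,E,c,\rho,s,T\rangle$ (finite), where $AP$ is a set of atomic propositions, $V$ is a set of vertices, $s\in V$ is the source, $T\subseteq V\setminus\{s\}$ is a set of target vertices, $E\subseteq (V\setminus T)\times(V\setminus\{s\})$ is a set of directed edges, $c:E\to\mathbb{N}$ is a capacity function, and $\rho:V\to 2^{AP}$ labels vertices. All $t\in T$ are assumed reachable from $s$, and each vertex has at least one target reachable from it. Let $E^u$ and $E_u$ be the sets of edges entering and leaving $u$. A flow function is $f:E\to\mathbb{N}$ with $f(e)\le c(e)$ for all $e\in E$ and $\sum_{e\in E^v}f(e)=\sum_{e\in E_v}f(e)$ for all $v\in V\setminus(\{s\}\cup T)$. Let $f(s)=\sum_{e\in E_s}f(e)$. The value of the maximal flow is $\max_f f(s)$ over all flow functions $f$. **Unwinding.** The unwinding of $N$ is the tree-shaped network $N_t=\langle AP,V',E',c',\rho',s,T'\rangle$, where $V'\subseteq V^*$ is the smallest set such that $s\in V'$ and, whenever $w\cdot v\in V'$ with $w\in V^*$, $v\in V\setminus T$, and $\langle v,u\rangle\in E$, then $w\cdot v\cdot u\in V'$, with $\rho'(w\cdot v\cdot u)=\rho(u)$; moreover $\langle w\cdot v,w\cdot v\cdot u\rangle\in E'$ with $c'(\langle w\cdot v,w\cdot v\cdot u\rangle)=c(\langle v,u\rangle)$; and $T'=V'\cap(V^*\cdot T)$.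 ($\rho'(s)=\rho(s)$. $N_t$ may be infinite; flow functions and the maximal flow in $N_t$ are defined by the same clauses.) -}

module Defs where

open import Level using (0ℓ)
open import Data.Empty using (⊥; ⊥-elim)
open import Data.Fin using (Fin; zero)
open import Data.List using (List; []; _∷_)
open import Data.Nat using (ℕ; _≤_)
open import Data.Nat.Properties using (+-0-commutativeMonoid)
open import Data.Product using (Σ; ∃; ∃-syntax; _×_; _,_; proj₁; proj₂)
open import Function using (_∘_)
open import Function.Bundles using (_↔_; mk↔ₛ′; module Inverse)
open import Function.Construct.Composition using (_↔-∘_)
open import Relation.Binary.Construct.Closure.ReflexiveTransitive
  using (Star; ε; _◅_; _◅◅_)
open import Relation.Binary.Core using (Rel)
open import Relation.Binary.Definitions using (Irrelevant)
open import Relation.Binary.PropositionalEquality using (_≡_; _≢_; refl; cong)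
open import Relation.Nullary using (¬_)
open import Relation.Unary using (Pred; _∈_; _∉_) renaming (Irrelevant to Irrelevant₁)

open import Algebra.Properties.CommutativeMonoid.Sum +-0-commutativeMonoid using (sum)

IsFinite : Set → Set
IsFinite A = ∃[ n ] (A ↔ Fin n)

-- By commutativity, the value does not depend on the chosen bijection.
sumOver : {A : Set} → IsFinite A → (A → ℕ) → ℕ
sumOver (_ , A↔Fin) g = sum (g ∘ Inverse.from A↔Fin)

-- Networks are only required to be locally finite, so that the same notions of
-- flow and of maximal flow apply both to a finite network and to its (possibly
-- infinite) unwinding.  Finiteness of the whole network is the separate
-- predicate `Finite`.
record Network : Set₁ where
  field
    AP : Set
    V  : Set
    E  : Rel V 0ℓ
    c  : ∀ {u v} → E u v → ℕ
    ρ  : V → Pred AP 0ℓ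
    s  : V
    T  : Pred V 0ℓ

    -- E is a subset of V × V: there are no parallel edges.
    E-irrelevant : Irrelevant E

    s∉T      : s ∉ T
    E-source : ∀ {u v} → E u v → u ∉ T
    E-target : ∀ {u v} → E u v → v ≢ s

    T-reachable      : ∀ {t} → t ∈ T → Star E s t
    reaches-a-target : ∀ v → ∃[ t ] (t ∈ T × Star E v t)

    finite-in  : ∀ v → IsFinite (∃[ u ] E u v)
    finite-out : ∀ u → IsFinite (∃[ v ] E u v)

record Finite (N : Network) : Set where
  open Network N
  field
    AP-finite : IsFinite AP
    V-finite  : IsFinite V

module _ (N : Network) where
  open Network N

  inflow outflow : (∀ {u v} → E u v → ℕ) → V → ℕ
  inflow  f v = sumOver (finite-in v)  (λ (_ , e) → f e)
  outflow f u = sumOver (finite-out u) (λ (_ , e) → f e)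

  record Flow : Set where
    field
      flow         : ∀ {u v} → E u v → ℕ
      capacity     : ∀ {u v} (e : E u v) → flow e ≤ c e
      conservation : ∀ v → v ≢ s → v ∉ T → inflow flow v ≡ outflow flow v

  value : Flow → ℕ
  value f = outflow (Flow.flow f) s

  IsMaxFlowValue : ℕ → Set
  IsMaxFlowValue m = (∃[ f ] value f ≡ m) × (∀ f → value f ≤ m)

-- A word is stored with its last letter at the head of the list, so that the
-- paths w · v · u extending w · v can be matched on directly.
pattern _·_ w v = v ∷ w
infixl 5 _·_

module Unwinding (N : Network) where
  open Network N

  data IsPath : Pred (List V) 0ℓ where
    root : IsPath ([] · s)
    step : ∀ {w v u} → IsPath (w · v) → v ∉ T → E v u → IsPath (w · v · u)

  V′ : Set
  V′ = Σ (List V) IsPath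

  data E′ : Rel V′ 0ℓ where
    extend : ∀ {w v u p q} → E v u → E′ (w · v , p) (w · v · u , q)

  c′ : ∀ {x y} → E′ x y → ℕ
  c′ (extend e) = c e

  last : V′ → V
  last (w · v , _) = v

  s′ : V′
  s′ = [] · s , root

  T′ : Pred V′ 0ℓ
  T′ x = last x ∈ T

  -- Hence V′ really is a subset of the set of words.
  IsPath-irrelevant : Irrelevant₁ IsPath
  IsPath-irrelevant root         root         = refl
  IsPath-irrelevant (step p _ e) (step q _ d)
    with refl ← IsPath-irrelevant p q | refl ← E-irrelevant e d = refl

  E′-irrelevant : Irrelevant E′
  E′-irrelevant (extend e) (extend d) = cong extend (E-irrelevant e d)

  E′-source : ∀ {x y} → E′ x y → x ∉ T′
  E′-source (extend e) = E-source e

  E′-target : ∀ {x y} → E′ x y → y ≢ s′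
  E′-target (extend _) ()

  root-reaches : ∀ {w} (p : IsPath w) → Star E′ s′ (w , p)
  root-reaches root         = ε
  root-reaches (step p _ e) = root-reaches p ◅◅ extend e ◅ ε

  lift : ∀ {w v t} (p : IsPath (w · v)) → t ∈ T → Star E v t →
         ∃[ x ] (x ∈ T′ × Star E′ (w · v , p) x)
  lift p t∈T ε = _ , t∈T , ε
  lift p t∈T (e ◅ es) with lift (step p (E-source e) e) t∈T es
  ... | x , x∈T′ , es′ = x , x∈T′ , extend e ◅ es′

  reaches′ : ∀ x → ∃[ t ] (t ∈ T′ × Star E′ x t)
  reaches′ (w · v , p) with reaches-a-target v
  ... | t , t∈T , es = lift p t∈T es

  finite-in′ : ∀ y → IsFinite (∃[ x ] E′ x y)
  finite-in′ (_ , root) = 0 , mk↔ₛ′ (λ ()) (λ ()) (λ ()) (λ ())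
  finite-in′ (_ , step p _ e) = 1 , mk↔ₛ′
    (λ _ → zero) (λ _ → (_ , p) , extend e)
    (λ { zero → refl ; (Fin.suc ()) }) unique
    where
    unique : ∀ xe → ((_ , p) , extend e) ≡ xe
    unique ((_ , q) , extend d)
      with refl ← IsPath-irrelevant p q | refl ← E-irrelevant e d = refl

  out↔ : ∀ {w v} (p : IsPath (w · v)) → (∃[ y ] E′ (w · v , p) y) ↔ (∃[ u ] E v u)
  out↔ p = mk↔ₛ′
    (λ { (_ , extend e) → _ , e })
    (λ (_ , e) → (_ , step p (E-source e) e) , extend e)
    (λ _ → refl)
    inverse
    where
    inverse : ∀ ye → _ ≡ ye
    inverse ((_ , q) , extend e)
      with refl ← IsPath-irrelevant (step p (E-source e) e) q = refl

  finite-out′ : ∀ x → IsFinite (∃[ y ] E′ x y)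
  finite-out′ (w · v , p) = let n , out↔Fin = finite-out v in
    n , (out↔Fin ↔-∘ out↔ p)

  unwinding : Network
  unwinding = record
    { AP = AP
    ; V  = V′
    ; E  = E′
    ; c  = c′
    ; ρ  = ρ ∘ last
    ; s  = s′
    ; T  = T′
    ; E-irrelevant     = E′-irrelevant
    ; s∉T              = s∉T
    ; E-source         = E′-source
    ; E-target         = E′-target
    ; T-reachable      = λ {x} _ → root-reaches (proj₂ x)
    ; reaches-a-target = reaches′
    ; finite-in        = finite-in′
    ; finite-out       = finite-out′
    }

open Unwinding public using (unwinding)

{-# OPTIONS --safe #-}

-- The network has edges s → a, s → d, a → d and d → t, all of capacity 1.  The
-- edge d → t is a bottleneck for the two paths from s to t, so the maximal flow
-- is 1.  The unwinding separates the two paths, duplicating d → t, so there the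
-- flow that saturates every edge is legal and has value 2.
module Submission where

open import Data.Empty using (⊥)
open import Data.Fin using (zero; suc)
open import Data.Nat using (_+_; _≤_; z≤n)
open import Data.Nat.Properties using (≤-refl; +-mono-≤; +-identityʳ; +-comm; module ≤-Reasoning)
open import Data.Product using (∃-syntax; _×_; _,_)
open import Function.Bundles using (mk↔ₛ′)
open import Relation.Binary.Construct.Closure.ReflexiveTransitive using (Star; ε; _◅_)
open import Relation.Binary.Definitions using (Irrelevant)
open import Relation.Binary.PropositionalEquality using (_≡_; _≢_; refl; sym; trans; cong)
open import Relation.Nullary using (¬_; contradiction)
open import Defs

data Vertex : Set where
  s a d t : Vertex

data Edge : Vertex → Vertex → Set where
  sa : Edge s a
  sd : Edge s d
  ad : Edge a d
  dt : Edge d t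

Edge-irrelevant : Irrelevant Edge
Edge-irrelevant sa sa = refl
Edge-irrelevant sd sd = refl
Edge-irrelevant ad ad = refl
Edge-irrelevant dt dt = refl

reaches-t : ∀ v → Star Edge v t
reaches-t s = sd ◅ dt ◅ ε
reaches-t a = ad ◅ dt ◅ ε
reaches-t d = dt ◅ ε
reaches-t t = ε

empty-finite : {A : Set} → ¬ A → IsFinite A
empty-finite ¬x = 0 , mk↔ₛ′ (λ x → contradiction x ¬x) (λ ()) (λ ()) (λ x → contradiction x ¬x)

contractible-finite : {A : Set} (x : A) → (∀ y → x ≡ y) → IsFinite A
contractible-finite x x≡ = 1 , mk↔ₛ′ (λ _ → zero) (λ _ → x) (λ { zero → refl ; (suc ()) }) x≡

edges-into : ∀ v → IsFinite (∃[ u ] Edge u v)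
edges-into s = empty-finite λ ()
edges-into a = contractible-finite (s , sa) λ { (_ , sa) → refl }
-- The only vertex with two incoming edges: the paths from `s` merge here, and this merging is what
-- the unwinding undoes.
edges-into d = 2 , mk↔ₛ′
  (λ { (_ , sd) → zero ; (_ , ad) → suc zero })
  (λ { zero → _ , sd ; (suc zero) → _ , ad })
  (λ { zero → refl ; (suc zero) → refl })
  (λ { (_ , sd) → refl ; (_ , ad) → refl })
edges-into t = contractible-finite (d , dt) λ { (_ , dt) → refl }

edges-from : ∀ u → IsFinite (∃[ v ] Edge u v)
edges-from s = 2 , mk↔ₛ′
  (λ { (_ , sa) → zero ; (_ , sd) → suc zero })
  (λ { zero → _ , sa ; (suc zero) → _ , sd })
  (λ { zero → refl ; (suc zero) → refl })
  (λ { (_ , sa) → refl ; (_ , sd) → refl })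
edges-from a = contractible-finite (d , ad) λ { (_ , ad) → refl }
edges-from d = contractible-finite (t , dt) λ { (_ , dt) → refl }
edges-from t = empty-finite λ ()

Vertex-finite : IsFinite Vertex
Vertex-finite = 4 , mk↔ₛ′
  (λ { s → zero ; a → suc zero ; d → suc (suc zero) ; t → suc (suc (suc zero)) })
  (λ { zero → s ; (suc zero) → a ; (suc (suc zero)) → d ; (suc (suc (suc zero))) → t })
  (λ { zero → refl ; (suc zero) → refl
     ; (suc (suc zero)) → refl ; (suc (suc (suc zero))) → refl })
  (λ { s → refl ; a → refl ; d → refl ; t → refl })

network : Network
network = record
  { AP = ⊥
  ; V  = Vertex
  ; E  = Edge
  ; c  = λ _ → 1
  ; ρ  = λ _ ()
  ; s  = s
  ; T  = _≡ t
  ; E-irrelevant     = Edge-irrelevant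
  ; s∉T              = λ ()
  ; E-source         = λ { sa () ; sd () ; ad () ; dt () }
  ; E-target         = λ { sa () ; sd () ; ad () ; dt () }
  ; T-reachable      = λ { refl → reaches-t s }
  ; reaches-a-target = λ v → t , refl , reaches-t v
  ; finite-in        = edges-into
  ; finite-out       = edges-from
  }

network-finite : Finite network
network-finite = record
  { AP-finite = empty-finite λ ()
  ; V-finite  = Vertex-finite
  }

-- One unit along s → d → t already fills the bottleneck, so the bound `value≤1` is attained.
flow-along-sdt : Flow network
flow-along-sdt = record
  { flow         = λ { sa → 0 ; sd → 1 ; ad → 0 ; dt → 1 }
  ; capacity     = λ { sa → z≤n ; sd → ≤-refl ; ad → z≤n ; dt → ≤-refl }
  ; conservation = λ
    { s s≢s _   → contradiction refl s≢s
    ; a _   _   → refl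
    ; d _   _   → refl
    ; t _   t∉T → contradiction refl t∉T
    }
  }

-- Everything leaving `s` passes through `d`: conservation at `a` trades `flow sa` for `flow ad`,
-- which makes the value the inflow of `d`, and conservation at `d` turns that into `flow dt`.
value≤1 : ∀ f → value network f ≤ 1
value≤1 f = begin
  flow sa + (flow sd + 0) ≡⟨ cong (_+ (flow sd + 0)) sa≡ad ⟩
  flow ad + (flow sd + 0) ≡⟨ cong (flow ad +_) (+-identityʳ (flow sd)) ⟩
  -- The sum is brought into the exact form to which the inflow of `d` computes: the order of
  -- `edges-into d`, with the final 0 left by `sum`.
  flow ad + flow sd       ≡⟨ +-comm (flow ad) (flow sd) ⟩
  flow sd + flow ad       ≡⟨ cong (flow sd +_) (+-identityʳ (flow ad)) ⟨
  flow sd + (flow ad + 0) ≡⟨ conservation d (λ ()) (λ ()) ⟩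
  flow dt + 0             ≡⟨ +-identityʳ (flow dt) ⟩
  flow dt                 ≤⟨ capacity dt ⟩
  1                       ∎
  where
  open Flow f
  open ≤-Reasoning
  sa≡ad : flow sa ≡ flow ad
  sa≡ad = trans (sym (+-identityʳ (flow sa)))
         (trans (conservation a (λ ()) (λ ())) (+-identityʳ (flow ad)))

open Unwinding network using (root; step; extend)

-- In a tree every vertex but the root has one incoming edge, and copies of `a` and `d` inherit a
-- single outgoing edge, so a constant flow is conserved there.
saturating-flow : Flow (unwinding network)
saturating-flow = record
  { flow         = λ _ → 1
  ; capacity     = λ { (extend _) → ≤-refl }
  ; conservation = λ
    -- The last edge of a path fixes its end vertex: `sd` and `ad` give the two copies of `d`, while
    -- `dt` leads to a target.
    { (_ , root)        x≢s′ _    → contradiction refl x≢s′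
    ; (_ , step _ _ sa) _    _    → refl
    ; (_ , step _ _ sd) _    _    → refl
    ; (_ , step _ _ ad) _    _    → refl
    ; (_ , step _ _ dt) _    x∉T′ → contradiction refl x∉T′
    }
  }

-- The edges leaving the root form a cut of capacity 1 + 1.
unwinding-value≤2 : ∀ f → value (unwinding network) f ≤ 2
unwinding-value≤2 f = +-mono-≤ (capacity (extend sa)) (+-mono-≤ (capacity (extend sd)) z≤n)
  where open Flow f

proposition3p2 : ∃[ N ] (Finite N × ∃[ m ] ∃[ m′ ] (IsMaxFlowValue N m × IsMaxFlowValue (unwinding N) m′ × m ≢ m′))
proposition3p2 =
  network , network-finite , 1 , 2 ,
  ((flow-along-sdt , refl) , value≤1) ,
  ((saturating-flow , refl) , unwinding-value≤2) ,
  λ ()
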